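{- There are arbitrarily large graphs $G$ such that, for the strict majority threshold assignment $\tau$, $\overleftrightarrow{MT}(G,\tau)=\omega\big(\overleftrightarrow{MDTT}(G,\tau)\big)$. That is, there is a sequence of finite simple graphs $G_1,G_2,\ldots$ with $|V(G_j)|\to\infty$ such that, with $\tau_j$ the strict majority threshold assignment of $G_j$, $\overleftrightarrow{MT}(G_j,\tau_j)/\overleftrightarrow{MDTT}(G_j,\tau_j)\to\infty$ as $j\to\infty$.
   Context: Graphs $G=(V,E)$ are finite, simple and undirected; $N(v)$ is the set of neighbors of $v$ and $d(v)=|N(v)|$. A threshold assignment is a function $\tau:V\to\mathbb{N}\cup\{0\}$ with $0\le\tau(v)\le d(v)$ for all $v$. The strict majority threshold assignment is $\tau(v)=\lceil (d(v)+1)/2\rceil$. Non-progressive threshold model: each node is positive or negative; in each discrete time step, all nodes update simultaneously, and $v$ becomes (or remains) positive if at least $\tau(v)$ of its neighbors are positive, and becomes (or remains) negative otherwise. Let $\mathcal{A}_i$ be the set of positive nodes in step $i$. A set $\mathcal{S}\subseteq V$ is a target set (TS) in the non-progressive model if starting from $\mathcal{A}_0=\mathcal{S}$ we have $\mathcal{A}_i=V$ for some $i\in\mathbb{N}$. $\overleftrightarrow{MT}(G,\tau)$ is the minimum size of a TS in the non-progressive model. A finite sequence $\mathcal{S}_0,\ldots,\mathcal{S}_k$ of subsets of $V$ (for some integer $k$) is a timed target set (TTS) if there is a sequence $Q_0,\ldots,Q_k$ of subsets of $V$ such that (i) $Q_0=\emptyset$; (ii) for $i\ge1$, $v\in Q_i$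 if and only if $|N(v)\cap(\mathcal{S}_{i-1}\cup Q_{i-1})|\ge\tau(v)$; (iii) $\mathcal{S}_k=\emptyset$; (iv) $Q_k=V$. Its size is $\sum_{i=0}^k|\mathcal{S}_i|$. A disjoint TTS is a TTS with $\mathcal{S}_i\cap\mathcal{S}_j=\emptyset$ for all $i\ne j$, and $\overleftrightarrow{MDTT}(G,\tau)$ is the minimum size of a disjoint TTS. -}

module Defs where

open import Data.Fin.Base using (Fin; zero; suc; inject₁; fromℕ)
open import Data.Fin.Subset using (Subset; _∈_; _∉_; _∩_; _∪_; ⊤; ⊥; ∣_∣; Empty)
open import Data.Nat.Base using (ℕ; zero; suc; _+_; _*_; _≤_; _<_; ⌈_/2⌉)
open import Data.Nat.Properties using (_≤?_)
open import Data.Product.Base using (∃-syntax; _×_)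
open import Data.Vec.Base using (tabulate)
open import Data.Vec.Functional using (Vector; foldr)
open import Function.Bundles using (_⇔_)
open import Relation.Binary.PropositionalEquality.Core using (_≡_; _≢_)
open import Relation.Nullary.Decidable.Core using (does)

record Graph : Set where
  field
    order       : ℕ
    N           : Fin order → Subset order
    symmetric   : ∀ {u v} → u ∈ N v → v ∈ N u
    irreflexive : ∀ {v} → v ∉ N v

  V : Set
  V = Fin order

  deg : V → ℕ
  deg v = ∣ N v ∣

open Graph public

IsThresholdAssignment : (G : Graph) → (V G → ℕ) → Set
IsThresholdAssignment G τ = ∀ v → τ v ≤ deg G v

-- At an isolated vertex this is 1 > 0 = deg, so it is a threshold assignment
-- exactly when the graph has no isolated vertex.
strictMajority : (G : Graph) → V G → ℕ
strictMajority G v = ⌈ deg G v + 1 /2⌉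

module _ (G : Graph) (τ : V G → ℕ) where

  step : Subset (order G) → Subset (order G)
  step A = tabulate λ v → does (τ v ≤? ∣ N G v ∩ A ∣)

  -- The set 𝒜ᵢ of positive nodes in step i, starting from 𝒜₀ = S.
  positive : Subset (order G) → ℕ → Subset (order G)
  positive S zero    = S
  positive S (suc i) = step (positive S i)

  IsTargetSet : Subset (order G) → Set
  IsTargetSet S = ∃[ i ] positive S i ≡ ⊤

  -- The sequence S₀, …, S_k is a vector of length k + 1.
  record IsTimedTargetSet (k : ℕ) (S : Vector (Subset (order G)) (suc k)) : Set where
    field
      Q         : Vector (Subset (order G)) (suc k)
      Q-initial : Q zero ≡ ⊥
      Q-step    : ∀ (i : Fin k) v →
                  v ∈ Q (suc i) ⇔ τ v ≤ ∣ N G v ∩ (S (inject₁ i) ∪ Q (inject₁ i)) ∣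
      S-final   : S (fromℕ k) ≡ ⊥
      Q-final   : Q (fromℕ k) ≡ ⊤

  IsDisjointTimedTargetSet : (k : ℕ) → Vector (Subset (order G)) (suc k) → Set
  IsDisjointTimedTargetSet k S =
    IsTimedTargetSet k S × (∀ i j → i ≢ j → Empty (S i ∩ S j))

size : ∀ {n l} → Vector (Subset n) l → ℕ
size = foldr (λ A s → ∣ A ∣ + s) 0

IsMinimum : (ℕ → Set) → ℕ → Set
IsMinimum P m = P m × (∀ s → P s → m ≤ s)

IsMT : (G : Graph) → (V G → ℕ) → ℕ → Set
IsMT G τ = IsMinimum λ s → ∃[ S ] (IsTargetSet G τ S × ∣ S ∣ ≡ s)

IsMDTT : (G : Graph) → (V G → ℕ) → ℕ → Set
IsMDTT G τ = IsMinimum λ s →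
  ∃[ k ] ∃[ S ] (IsDisjointTimedTargetSet G τ k S × size S ≡ s)

TendsToInfinity : (ℕ → ℕ) → Set
TendsToInfinity f = ∀ M → ∃[ j₀ ] (∀ j → j₀ ≤ j → M ≤ f j)

-- f j / g j → ∞ with the division cleared. The inequality is strict so that
-- f j = g j = 0 is not accepted as a large ratio.
RatioTendsToInfinity : (f g : ℕ → ℕ) → Set
RatioTendsToInfinity f g = ∀ C → ∃[ j₀ ] (∀ j → j₀ ≤ j → C * g j < f j)

{-# OPTIONS --safe #-}
-- In a bipartite graph between high-degree hubs and low-degree vertices the process splits into
-- two independent halves: hubs at even times with low-degree vertices at odd times, and the
-- converse. A small set can only start the first half, because activating a hub in one step from
-- low-degree vertices takes more than half of its degree. A timed target set can start both, by
-- seeding hubs at an even and at an odd time. No two disjoint sets of hubs can each start a half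
-- in one go, since strict majority is dominated by its own dual; but seeds spread over several
-- steps can. The graph is the incidence graph of a fixed 3-uniform hypergraph on eight hubs,
-- invariant under the involution 2i ↔ 2i + 1: the seeds {0,4,6}, then {2}, ignite one half, and
-- their mirror images, one step later, the other. Replacing every hyperedge vertex by m twins
-- preserves the eight seeds, while a target set must have more than m / 2 vertices.
module Submission where

open import Defs
open import Data.Bool.Base using (Bool; true; false; _∧_; _∨_)
import Data.Bool.Properties as Bool
open import Data.Fin using (#_)
open import Data.Fin.Base
  using ( Fin; zero; suc; fromℕ; fromℕ<; inject₁; splitAt; _↑ˡ_; _↑ʳ_; combine; remQuot; finToFun
        ; funToFin )
import Data.Fin.Properties as Fin
open import Data.Fin.Subset
  using ( Subset; inside; outside; _∈_; _∉_; _⊃_; ⁅_⁆; _∪_; _∩_; ⊤; ⊥; ∣_∣; Empty )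
open import Data.Fin.Subset.Induction using (Acc; acc; ⊃-wellFounded)
open import Data.Fin.Subset.Properties
open import Data.Nat.Base
import Data.Nat.Properties as ℕ
open import Data.Product.Base using (∃-syntax; Σ-syntax; _×_; _,_; proj₁; proj₂)
import Data.Product.Properties as Product
open import Data.Sum.Base using (_⊎_; inj₁; inj₂; [_,_]; map₂)
open import Data.Vec.Base using (Vec; []; _∷_; _++_; here; lookup; replicate; tabulate; zipWith)
open import Data.Vec.Functional as Vector using (Vector)
import Data.Vec.Properties as Vec
open import Function.Base using (_∘_; case_of_; id)
open import Function.Bundles
  using (_⇔_; _↪_; mk⇔; mk↪; module Equivalence; module Inverse; module RightInverse)
open import Function.Construct.Composition using (_⇔-∘_)
open import Level using (0ℓ)
open import Relation.Binary.Construct.Closure.ReflexiveTransitive using (Star; ε; _◅_; _◅◅_; gmap)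
open import Relation.Binary.Core using (Rel)
open import Relation.Binary.Definitions using (Decidable; DecidableEquality)
open import Relation.Binary.PropositionalEquality hiding ([_])
open import Relation.Nullary.Decidable
  using (Dec; yes; no; ¬?; _×-dec_; map′; does; does-⇔; dec-true; decidable-stable; from-yes)
open import Relation.Nullary.Negation.Core using (¬_; contradiction)

-- Decidable reachability in finite state spaces, and least witnesses

Star? : ∀ {X : Set} {n} → X ↪ Fin n → {R : Rel X 0ℓ} → Decidable R → Decidable (Star R)
Star? {X} {n} X↪Fin {R} R? x y = search ⁅ to x ⁆ (⊃-wellFounded _) (x∈⁅x⁆ _) λ i∈ →
    subst (Star R x) (sym (trans (cong from (x∈⁅y⁆⇒x≡y _ i∈)) (strictlyInverseʳ x))) ε
  where
  open RightInverse X↪Fin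
  -- `W` holds codes of states already known to be reachable from `x`. Each round adds the target of
  -- an edge leaving `W`, so `W` grows strictly and the recursion is well-founded.
  search : (W : Subset n) → Acc _⊃_ W → to x ∈ W → (∀ {i} → i ∈ W → Star R x (from i)) →
           Dec (Star R x y)
  search W (acc larger) x∈W reached
    with Fin.any? (λ i → Fin.any? λ j → i ∈? W ×-dec ¬? (j ∈? W) ×-dec R? (from i) (from j))
  ... | yes (i , j , i∈W , j∉W , r) =
    search (W ∪ ⁅ j ⁆) (larger (p⊆p∪q _ , j , x∈p∪q⁺ (inj₂ (x∈⁅x⁆ j)) , j∉W)) (p⊆p∪q _ x∈W)
      λ k∈ → case x∈p∪q⁻ W _ k∈ of λ where
        (inj₁ k∈W) → reached k∈W
        (inj₂ k∈⁅j⁆) → subst (Star R x ∘ from) (sym (x∈⁅y⁆⇒x≡y j k∈⁅j⁆)) (reached i∈W ◅◅ (r ◅ ε))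
  -- No edge leaves `W`, so no path from `x` does, and membership of `to y` in `W` decides
  -- reachability.
  ... | no closed = map′ (λ y∈W → subst (Star R x) (strictlyInverseʳ y) (reached y∈W)) (stays x∈W)
                         (to y ∈? W)
    where
    stays : ∀ {z} → to z ∈ W → Star R z y → to y ∈ W
    stays z∈W ε = z∈W
    stays {z} z∈W (_◅_ {j = z′} r rs) = stays (decidable-stable (to z′ ∈? W) λ z′∉W →
      closed (to z , to z′ , z∈W , z′∉W ,
              subst₂ R (sym (strictlyInverseʳ z)) (sym (strictlyInverseʳ z′)) r)) rs

Subset↪Fin : ∀ n → Subset n ↪ Fin (2 ^ n)
Subset↪Fin n = mk↪ {to = funToFin ∘ (from ∘_) ∘ lookup} {from = tabulate ∘ (to ∘_) ∘ finToFun}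
  λ { {A} refl → trans
    (Vec.tabulate-cong λ i →
      trans (cong to (Fin.finToFun-funToFin (from ∘ lookup A) i)) (strictlyInverseˡ _))
    (Vec.tabulate∘lookup A) }
  where open Inverse Fin.2↔Bool

×↪Fin : ∀ {X Y : Set} {m n} → X ↪ Fin m → Y ↪ Fin n → (X × Y) ↪ Fin (m * n)
×↪Fin {m = m} {n} f g = mk↪ {to = λ (x , y) → combine (F.to x) (G.to y)}
  {from = λ i → F.from (proj₁ (remQuot {m} n i)) , G.from (proj₂ (remQuot {m} n i))}
  λ { {x , y} refl → cong₂ _,_
    (trans (cong (F.from ∘ proj₁) (Fin.remQuot-combine (F.to x) (G.to y))) (F.strictlyInverseʳ x))
    (trans (cong (G.from ∘ proj₂) (Fin.remQuot-combine (F.to x) (G.to y))) (G.strictlyInverseʳ y)) }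
  where
  module F = RightInverse f
  module G = RightInverse g

-- Candidates are tried upwards from 0. The known witness is written `d + lo`, so every failed
-- candidate shortens the distance `d`, and `d ≤ fuel` prevents the fuel from running out first.
minimum : {P : ℕ → Set} → (∀ s → Dec (P s)) → ∀ s → P s → ∃[ m ] IsMinimum P m
minimum {P} P? s Ps = search s 0 (s , ℕ.≤-refl , subst P (sym (ℕ.+-identityʳ s)) Ps) (λ _ _ → z≤n)
  where
  search : ∀ fuel lo → (∃[ d ] d ≤ fuel × P (d + lo)) → (∀ s → P s → lo ≤ s) →
           ∃[ m ] IsMinimum P m
  search fuel lo found lower with P? lo
  ... | yes p = lo , p , lower
  ... | no ¬p with fuel | found
  ... | _ | zero , _ , p = contradiction p ¬p
  ... | suc fuel | suc d , s≤s d≤ , p =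
    search fuel (suc lo) (d , d≤ , subst P (sym (ℕ.+-suc d lo)) p)
      λ s Ps → ℕ.≤∧≢⇒< (lower s Ps) λ { refl → ¬p Ps }

-- Disjointness and cardinality of subsets

infix 4 _≟ˢ_
_≟ˢ_ : ∀ {n} → DecidableEquality (Subset n)
_≟ˢ_ = Vec.≡-dec Bool._≟_

∈-tabulate : ∀ {n} (f : Fin n → Bool) {i} → i ∈ tabulate f ⇔ f i ≡ true
∈-tabulate f {i} = mk⇔
  (λ i∈ → trans (sym (Vec.lookup∘tabulate f i)) (Vec.[]=⇒lookup i∈))
  (λ fi → Vec.lookup⇒[]= i _ (trans (Vec.lookup∘tabulate f i) fi))

Empty-∩-comm : ∀ {n} {A B : Subset n} → Empty (A ∩ B) → Empty (B ∩ A)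
Empty-∩-comm {A = A} {B} = subst Empty (∩-comm A B)

Empty-∩-∪⁺ : ∀ {n} {A B C : Subset n} → Empty (A ∩ B) → Empty (A ∩ C) → Empty (A ∩ (B ∪ C))
Empty-∩-∪⁺ {A = A} {B} {C} AB AC (x , x∈) with x∈p∩q⁻ A (B ∪ C) x∈
... | x∈A , x∈B∪C with x∈p∪q⁻ B C x∈B∪C
... | inj₁ x∈B = AB (x , x∈p∩q⁺ (x∈A , x∈B))
... | inj₂ x∈C = AC (x , x∈p∩q⁺ (x∈A , x∈C))

Empty-∩-∪⁻ : ∀ {n} {A B C : Subset n} → Empty (A ∩ (B ∪ C)) → Empty (A ∩ B) × Empty (A ∩ C)
Empty-∩-∪⁻ {A = A} {B} {C} ∅ =
  (λ (x , x∈) → let x∈A , x∈B = x∈p∩q⁻ A B x∈ in ∅ (x , x∈p∩q⁺ (x∈A , x∈p∪q⁺ (inj₁ x∈B)))) ,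
  (λ (x , x∈) → let x∈A , x∈C = x∈p∩q⁻ A C x∈ in ∅ (x , x∈p∩q⁺ (x∈A , x∈p∪q⁺ (inj₂ x∈C))))

Empty-∩⇒∣∪∣ : ∀ {n} (A B : Subset n) → Empty (A ∩ B) → ∣ B ∪ A ∣ ≡ ∣ A ∣ + ∣ B ∣
Empty-∩⇒∣∪∣ []            []            _  = refl
Empty-∩⇒∣∪∣ (inside ∷ A)  (inside ∷ B)  ∅  = contradiction (zero , here) ∅
Empty-∩⇒∣∪∣ (inside ∷ A)  (outside ∷ B) ∅  = cong suc (Empty-∩⇒∣∪∣ A B (drop-∷-Empty ∅))
Empty-∩⇒∣∪∣ (outside ∷ A) (inside ∷ B)  ∅  =
  trans (cong suc (Empty-∩⇒∣∪∣ A B (drop-∷-Empty ∅))) (sym (ℕ.+-suc _ _))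
Empty-∩⇒∣∪∣ (outside ∷ A) (outside ∷ B) ∅  = Empty-∩⇒∣∪∣ A B (drop-∷-Empty ∅)

-- Existence of both minima for arbitrary thresholds

module _ (G : Graph) (τ : V G → ℕ) where

  ∈-step : ∀ {A v} → v ∈ step G τ A ⇔ τ v ≤ ∣ N G v ∩ A ∣
  ∈-step {A} {v} = mk⇔
    (λ v∈ → holds (τ v ℕ.≤? _) (Equivalence.to (∈-tabulate _) v∈))
    (λ le → Equivalence.from (∈-tabulate _) (dec-true (τ v ℕ.≤? _) le))
    where
    holds : ∀ {P : Set} (P? : Dec P) → does P? ≡ true → P
    holds (yes p) _ = p

  -- Turns the unbounded search for a time `i` into reachability among the finitely many vertex
  -- subsets, which `Star?` decides.
  Star-positive : ∀ S → (∃[ i ] positive G τ S i ≡ ⊤) ⇔ Star (λ A B → B ≡ step G τ A) S ⊤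
  Star-positive S = mk⇔ (λ (i , eq) → subst (Star _ S) eq (forward i)) backward
    where
    forward : ∀ i → Star (λ A B → B ≡ step G τ A) S (positive G τ S i)
    forward zero = ε
    forward (suc i) = forward i ◅◅ (refl ◅ ε)
    shift : ∀ A i → positive G τ (step G τ A) i ≡ positive G τ A (suc i)
    shift A zero = refl
    shift A (suc i) = cong (step G τ) (shift A i)
    backward : ∀ {A} → Star (λ A B → B ≡ step G τ A) A ⊤ → ∃[ i ] positive G τ A i ≡ ⊤
    backward ε = 0 , refl
    backward {A} (refl ◅ rs) with i , eq ← backward rs = suc i , trans (sym (shift A i)) eq

  targetSet? : ∀ S → Dec (IsTargetSet G τ S)
  targetSet? S = map′ (Equivalence.from (Star-positive S)) (Equivalence.to (Star-positive S))
    (Star? (Subset↪Fin _) (λ A B → B ≟ˢ step G τ A) S ⊤)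

  ∃MT : ∃[ mt ] IsMT G τ mt
  ∃MT = minimum (λ s → anySubset? λ S → targetSet? S ×-dec ∣ S ∣ ℕ.≟ s) _ (⊤ , (0 , refl) , refl)

  -- The active vertices and the vertices seeded so far. A disjoint timed target set has as many
  -- seeds as its union, so reachability among these finitely many states decides which sizes occur.
  State : Set
  State = Subset (order G) × Subset (order G)

  infix 4 _⟶_
  _⟶_ : State → State → Set
  (Q , U) ⟶ x = ∃[ S ] Empty (S ∩ U) × x ≡ (step G τ (S ∪ Q) , U ∪ S)

  _⟶?_ : Decidable _⟶_
  (Q , U) ⟶? x = anySubset? λ S → ¬? (nonempty? (S ∩ U)) ×-dec Product.≡-dec _≟ˢ_ _≟ˢ_ x _

  -- A disjoint timed target set resumed from an arbitrary state: `Q₀` is already active and `U₀`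
  -- already used up. This generality lets the first time step be added or removed by induction.
  record Schedule (k : ℕ) (Q₀ U₀ : Subset (order G)) (s : ℕ) : Set where
    field
      S Q      : Vector (Subset (order G)) (suc k)
      start    : Q zero ≡ Q₀
      next     : ∀ i → Q (suc i) ≡ step G τ (S (inject₁ i) ∪ Q (inject₁ i))
      S-final  : S (fromℕ k) ≡ ⊥
      Q-final  : Q (fromℕ k) ≡ ⊤
      fresh    : ∀ i → Empty (S i ∩ U₀)
      disjoint : ∀ i j → i ≢ j → Empty (S i ∩ S j)
      total    : size S ≡ s

  -- The cardinality equation holds because every seed set is disjoint from all seeds before it, so
  -- each union adds exactly its size. It replaces a sum over a sequence of unknown length by the
  -- size of one subset.
  Star⇒Schedule : ∀ {Q₀ U₀ W} → Star _⟶_ (Q₀ , U₀) (⊤ , W) →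
                  ∃[ k ] ∃[ s ] Schedule k Q₀ U₀ s × ∣ W ∣ ≡ s + ∣ U₀ ∣
  Star⇒Schedule {U₀ = U₀} ε = 0 , size {order G} {1} (λ _ → ⊥) , record
    { S = λ _ → ⊥ ; Q = λ _ → ⊤ ; start = refl ; next = λ () ; S-final = refl ; Q-final = refl
    ; fresh = λ _ (_ , x∈) → ∉⊥ (proj₁ (x∈p∩q⁻ ⊥ _ x∈))
    ; disjoint = λ { zero zero 0≢0 → contradiction refl 0≢0 } ; total = refl
    } , cong (_+ ∣ U₀ ∣) (sym (trans (ℕ.+-identityʳ _) (∣⊥∣≡0 (order G))))
  Star⇒Schedule {Q₀} {U₀} ((S₀ , S₀∅ , refl) ◅ rs) with k , s , sch , eq ← Star⇒Schedule rs =
    suc k , ∣ S₀ ∣ + s , record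
    { S = S₀ Vector.∷ S ; Q = Q₀ Vector.∷ Q ; start = refl
    ; next = λ { zero → start ; (suc i) → next i }
    ; S-final = S-final ; Q-final = Q-final
    -- Later seeds avoid `U₀ ∪ S₀`. Avoiding `U₀` is freshness; avoiding `S₀` gives the new
    -- disjointness clauses.
    ; fresh = λ { zero → S₀∅ ; (suc i) → proj₁ (Empty-∩-∪⁻ (fresh i)) }
    ; disjoint = λ where
        zero zero 0≢0 → contradiction refl 0≢0
        zero (suc j) _ → Empty-∩-comm (proj₂ (Empty-∩-∪⁻ {B = U₀} (fresh j)))
        (suc i) zero _ → proj₂ (Empty-∩-∪⁻ {B = U₀} (fresh i))
        (suc i) (suc j) i≢j → disjoint i j (i≢j ∘ cong suc)
    ; total = cong (∣ S₀ ∣ +_) total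
    } , (begin
      _                       ≡⟨ eq ⟩
      s + ∣ U₀ ∪ S₀ ∣         ≡⟨ cong (s +_) (Empty-∩⇒∣∪∣ S₀ U₀ S₀∅) ⟩
      s + (∣ S₀ ∣ + ∣ U₀ ∣)   ≡⟨ ℕ.+-assoc s _ _ ⟨
      s + ∣ S₀ ∣ + ∣ U₀ ∣     ≡⟨ cong (_+ ∣ U₀ ∣) (ℕ.+-comm s _) ⟩
      ∣ S₀ ∣ + s + ∣ U₀ ∣     ∎)
    where
    open Schedule sch
    open ≡-Reasoning

  Schedule⇒Star : ∀ k {Q₀ U₀ s} → Schedule k Q₀ U₀ s →
                  ∃[ W ] Star _⟶_ (Q₀ , U₀) (⊤ , W) × ∣ W ∣ ≡ s + ∣ U₀ ∣
  Schedule⇒Star zero {Q₀} {U₀} sch = U₀ , subst (λ Q → Star _⟶_ (Q₀ , U₀) (Q , U₀))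
      (trans (sym start) Q-final) ε
    , cong (_+ ∣ U₀ ∣) (trans (sym (trans (cong (λ A → ∣ A ∣ + 0) S-final)
        (trans (ℕ.+-identityʳ _) (∣⊥∣≡0 (order G))))) total)
    where open Schedule sch
  Schedule⇒Star (suc k) {Q₀} {U₀} {s} sch =
    let W , rs , eq = Schedule⇒Star k later in
    W , (S zero , fresh zero , refl) ◅ rs , (begin
      ∣ W ∣                                     ≡⟨ eq ⟩
      size (S ∘ suc) + ∣ U₀ ∪ S zero ∣
        ≡⟨ cong (size (S ∘ suc) +_) (Empty-∩⇒∣∪∣ _ _ (fresh zero)) ⟩
      size (S ∘ suc) + (∣ S zero ∣ + ∣ U₀ ∣)    ≡⟨ ℕ.+-assoc (size (S ∘ suc)) _ _ ⟨
      size (S ∘ suc) + ∣ S zero ∣ + ∣ U₀ ∣      ≡⟨ cong (_+ ∣ U₀ ∣) (ℕ.+-comm (size (S ∘ suc)) _) ⟩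
      size S + ∣ U₀ ∣                           ≡⟨ cong (_+ ∣ U₀ ∣) total ⟩
      s + ∣ U₀ ∣                                ∎)
    where
    open Schedule sch
    open ≡-Reasoning
    later : Schedule k (step G τ (S zero ∪ Q₀)) (U₀ ∪ S zero) (size (S ∘ suc))
    later = record
      { S = S ∘ suc ; Q = Q ∘ suc
      ; start = trans (next zero) (cong (λ A → step G τ (S zero ∪ A)) start)
      ; next = next ∘ suc ; S-final = S-final ; Q-final = Q-final
      ; fresh = λ i → Empty-∩-∪⁺ (fresh (suc i)) (disjoint (suc i) zero λ ())
      ; disjoint = λ i j i≢j → disjoint (suc i) (suc j) (i≢j ∘ Fin.suc-injective)
      ; total = refl }

  Star⇔disjointTTS : ∀ s →
    (∃[ W ] Star _⟶_ (⊥ , ⊥) (⊤ , W) × ∣ W ∣ ≡ s) ⇔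
    (∃[ k ] ∃[ S ] IsDisjointTimedTargetSet G τ k S × size S ≡ s)
  Star⇔disjointTTS s = mk⇔ forward backward
    where
    +∣⊥∣ : ∀ {s} → s + ∣ ⊥ {n = order G} ∣ ≡ s
    +∣⊥∣ {s} = trans (cong (s +_) (∣⊥∣≡0 (order G))) (ℕ.+-identityʳ s)
    forward : (∃[ W ] Star _⟶_ (⊥ , ⊥) (⊤ , W) × ∣ W ∣ ≡ s) →
              ∃[ k ] ∃[ S ] IsDisjointTimedTargetSet G τ k S × size S ≡ s
    forward (W , rs , ∣W∣≡s) with k , s′ , sch , eq ← Star⇒Schedule rs =
      let open Schedule sch in k , S ,
      (record { Q = Q ; Q-initial = start
              ; Q-step = λ i v → subst
                  (λ A → v ∈ A ⇔ τ v ≤ ∣ N G v ∩ (S (inject₁ i) ∪ Q (inject₁ i)) ∣)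
                  (sym (next i)) ∈-step
              ; S-final = S-final ; Q-final = Q-final } , disjoint) ,
      trans total (trans (sym +∣⊥∣) (trans (sym eq) ∣W∣≡s))
    backward : (∃[ k ] ∃[ S ] IsDisjointTimedTargetSet G τ k S × size S ≡ s) →
               ∃[ W ] Star _⟶_ (⊥ , ⊥) (⊤ , W) × ∣ W ∣ ≡ s
    backward (k , S , (tts , disjoint) , total) =
      let W , rs , eq = Schedule⇒Star k schedule in W , rs , trans eq +∣⊥∣
      where
      open IsTimedTargetSet tts
      schedule : Schedule k ⊥ ⊥ s
      schedule = record
        { S = S ; Q = Q ; start = Q-initial ; S-final = S-final ; Q-final = Q-final
        ; next = λ i → ⊆-antisym (λ {v} → Equivalence.from ∈-step ∘ Equivalence.to (Q-step i v))
                                  (λ {v} → Equivalence.from (Q-step i v) ∘ Equivalence.to ∈-step)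
        ; fresh = λ i (_ , x∈) → ∉⊥ (proj₂ (x∈p∩q⁻ _ _ x∈))
        ; disjoint = disjoint ; total = total }

  -- Whether a size occurs is decidable: there are finitely many candidates for the final seeded set
  -- `W`, and reachability of `(⊤ , W)` is decidable for each. The given path bounds the minimum
  -- from above.
  ∃MDTT : ∀ {W} → Star _⟶_ (⊥ , ⊥) (⊤ , W) → ∃[ mdtt ] IsMDTT G τ mdtt × mdtt ≤ ∣ W ∣
  ∃MDTT {W} rs = let mdtt , isMDTT = minimum P? ∣ W ∣ PW in mdtt , isMDTT , proj₂ isMDTT ∣ W ∣ PW
    where
    P : ℕ → Set
    P s = ∃[ k ] ∃[ S ] IsDisjointTimedTargetSet G τ k S × size S ≡ s
    P? : ∀ s → Dec (P s)
    P? s = map′ (Equivalence.to (Star⇔disjointTTS s)) (Equivalence.from (Star⇔disjointTTS s))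
      (anySubset? λ W → Star? (×↪Fin (Subset↪Fin _) (Subset↪Fin _)) _⟶?_ (⊥ , ⊥) (⊤ , W)
                        ×-dec ∣ W ∣ ℕ.≟ s)
    PW : P ∣ W ∣
    PW = Equivalence.to (Star⇔disjointTTS ∣ W ∣) (W , rs , refl)

-- A target set with at most `C * mdtt ≤ C * c` vertices has doubled size at most `2 * C * c`. This
-- is excluded as soon as `j` reaches that bound, which is therefore the starting index `j₀`.
unbounded-ratio : ∀ (G : ℕ → Graph) (τ : ∀ j → V (G j) → ℕ) c →
  (∀ j {S} → ∣ S ∣ + ∣ S ∣ ≤ j → ¬ IsTargetSet (G j) (τ j) S) →
  (∀ j → ∃[ W ] Star (_⟶_ (G j) (τ j)) (⊥ , ⊥) (⊤ , W) × ∣ W ∣ ≤ c) →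
  ∃[ mt ] ∃[ mdtt ] ((∀ j → IsMT (G j) (τ j) (mt j)) × (∀ j → IsMDTT (G j) (τ j) (mdtt j)) ×
                     RatioTendsToInfinity mt mdtt)
unbounded-ratio G τ c small seeding =
  (λ j → proj₁ (minMT j)) , (λ j → proj₁ (minMDTT j)) ,
  (λ j → proj₂ (minMT j)) , (λ j → proj₁ (proj₂ (minMDTT j))) ,
  λ C → C * c + C * c , λ j → ratio C j (proj₂ (minMT j)) (proj₂ (proj₂ (minMDTT j)))
  where
  minMT : ∀ j → ∃[ mt ] IsMT (G j) (τ j) mt
  minMT j = ∃MT (G j) (τ j)
  minMDTT : ∀ j → ∃[ mdtt ] IsMDTT (G j) (τ j) mdtt × mdtt ≤ c
  minMDTT j = let W , steps , ∣W∣≤c = seeding j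
                  mdtt , isMDTT , mdtt≤∣W∣ = ∃MDTT (G j) (τ j) steps
              in mdtt , isMDTT , ℕ.≤-trans mdtt≤∣W∣ ∣W∣≤c
  ratio : ∀ C j {mt mdtt} → IsMT (G j) (τ j) mt → mdtt ≤ c → C * c + C * c ≤ j → C * mdtt < mt
  ratio C j ((S , isTargetSet , refl) , _) mdtt≤c 2Cc≤j = ℕ.≰⇒> λ ∣S∣≤ →
    let ∣S∣≤Cc = ℕ.≤-trans ∣S∣≤ (ℕ.*-monoʳ-≤ C mdtt≤c) in
    small j (ℕ.≤-trans (ℕ.+-mono-≤ ∣S∣≤Cc ∣S∣≤Cc) 2Cc≤j) isTargetSet

-- Strict majority without rounding, and sizes of tabulated subsets

⌈n+1/2⌉≤c⇔n<c+c : ∀ n c → ⌈ n + 1 /2⌉ ≤ c ⇔ n < c + c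
⌈n+1/2⌉≤c⇔n<c+c n c rewrite ℕ.+-comm n 1 = mk⇔ (to n c) (from n c)
  where
  to : ∀ n c → suc ⌊ n /2⌋ ≤ c → n < c + c
  to zero          (suc c) _        = s≤s z≤n
  to (suc zero)    (suc c) _        = s≤s (ℕ.≤-trans (s≤s z≤n) (ℕ.≤-reflexive (sym (ℕ.+-suc c c))))
  to (suc (suc n)) (suc c) (s≤s le) =
    s≤s (ℕ.≤-trans (s≤s (to n c le)) (ℕ.≤-reflexive (sym (ℕ.+-suc c c))))
  from : ∀ n c → n < c + c → suc ⌊ n /2⌋ ≤ c
  from zero          (suc c) _        = s≤s z≤n
  from (suc zero)    (suc c) _        = s≤s z≤n
  from (suc (suc n)) (suc c) (s≤s lt) =
    s≤s (from n c (ℕ.≤-pred (ℕ.≤-trans lt (ℕ.≤-reflexive (ℕ.+-suc c c)))))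

zipWith-tabulate : ∀ {A B C : Set} {n} (_•_ : A → B → C) (f : Fin n → A) (g : Fin n → B) →
  zipWith _•_ (tabulate f) (tabulate g) ≡ tabulate λ i → f i • g i
zipWith-tabulate {n = zero}  _•_ f g = refl
zipWith-tabulate {n = suc n} _•_ f g = cong (_ ∷_) (zipWith-tabulate _•_ (f ∘ suc) (g ∘ suc))

∣∷∣ : ∀ {n} b (A : Subset n) → ∣ b ∷ A ∣ ≡ ∣ b ∷ [] ∣ + ∣ A ∣
∣∷∣ inside  A = refl
∣∷∣ outside A = refl

∣tabulate-+∣ : ∀ m {n} (f : Fin (m + n) → Bool) →
  ∣ tabulate f ∣ ≡ ∣ tabulate (f ∘ (_↑ˡ n)) ∣ + ∣ tabulate (f ∘ (m ↑ʳ_)) ∣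
∣tabulate-+∣ zero f = refl
∣tabulate-+∣ (suc m) {n} f = begin
  _ ≡⟨ ∣∷∣ (f zero) (tabulate (f ∘ suc)) ⟩
  _ ≡⟨ cong (∣ f zero ∷ [] ∣ +_) (∣tabulate-+∣ m (f ∘ suc)) ⟩
  _ ≡⟨ ℕ.+-assoc ∣ f zero ∷ [] ∣ _ _ ⟨
  _ ≡⟨ cong (_+ ∣ tabulate (f ∘ (suc m ↑ʳ_)) ∣) (∣∷∣ (f zero) (tabulate (f ∘ suc ∘ (_↑ˡ n)))) ⟨
  _ ∎
  where open ≡-Reasoning

-- The second component of `remQuot` forgets the copy, so each index of `Fin n` is met `m` times.
∣tabulate-remQuot∣ : ∀ m {n} (f : Fin n → Bool) →
  ∣ tabulate (f ∘ proj₂ ∘ remQuot {m} n) ∣ ≡ m * ∣ tabulate f ∣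
∣tabulate-remQuot∣ zero f = refl
∣tabulate-remQuot∣ (suc m) {n} f = begin
  _ ≡⟨ ∣tabulate-+∣ n _ ⟩
  _ ≡⟨ cong₂ (λ A B → ∣ A ∣ + ∣ B ∣)
         (Vec.tabulate-cong λ i → cong f (first i)) (Vec.tabulate-cong λ i → cong f (rest i)) ⟩
  _ ≡⟨ cong (∣ tabulate f ∣ +_) (∣tabulate-remQuot∣ m f) ⟩
  _ ∎
  where
  open ≡-Reasoning
  first : ∀ i → proj₂ (remQuot {suc m} n (i ↑ˡ (m * n))) ≡ i
  first i rewrite Fin.splitAt-↑ˡ n i (m * n) = refl
  rest : ∀ i → proj₂ (remQuot {suc m} n (n ↑ʳ i)) ≡ proj₂ (remQuot {m} n i)
  rest i rewrite Fin.splitAt-↑ʳ n (m * n) i = refl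

tabulate-replicate : ∀ {n} (b : Bool) → tabulate {n = n} (λ _ → b) ≡ replicate n b
tabulate-replicate {n} b = trans (Vec.tabulate-cong λ i → sym (Vec.lookup-replicate i b))
                                 (Vec.tabulate∘lookup (replicate n b))

-- Majority dynamics of a hypergraph and of its twin incidence graphs

module Hypergraph {k l} (inc : Fin k → Fin l → Bool) where

  hyperedges : Fin k → Subset l
  hyperedges u = tabulate (inc u)

  hubs : Fin l → Subset k
  hubs e = tabulate λ u → inc u e

  -- The majority is written as degree below twice the active count, a homogeneous inequality in
  -- which a common number of twins cancels.
  stepHubs : Subset l → Subset k
  stepHubs y = tabulate λ u →
    does (∣ hyperedges u ∣ ℕ.<? ∣ hyperedges u ∩ y ∣ + ∣ hyperedges u ∩ y ∣)

  stepHyperedges : Subset k → Subset l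
  stepHyperedges x = tabulate λ e →
    does (∣ hubs e ∣ ℕ.<? ∣ hubs e ∩ x ∣ + ∣ hubs e ∩ x ∣)

  -- Seeds are placed on hubs only, so the seeded vertices are recorded as a set of hubs.
  SeededState : Set
  SeededState = Subset k × Subset l × Subset k

  seed : Subset k → SeededState → SeededState
  seed s (x , y , u) = stepHubs y , stepHyperedges (s ∪ x) , u ∪ s

  infix 4 _⇝_
  _⇝_ : SeededState → SeededState → Set
  σ@(_ , _ , u) ⇝ σ′ = ∃[ s ] s ∩ u ≡ ⊥ × seed s σ ≡ σ′

  -- The incidence graph, with every hyperedge vertex replaced by m twins.
  module Twins (m : ℕ) where

    Node : Set
    Node = Fin k ⊎ Fin l

    n : ℕ
    n = k + m * l

    node : Fin n → Node
    node v = map₂ (proj₂ ∘ remQuot {m} l) (splitAt k v)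

    adjacent : Node → Node → Bool
    adjacent (inj₁ u) (inj₂ e) = inc u e
    adjacent (inj₂ e) (inj₁ u) = inc u e
    adjacent _        _        = false

    adjacent-sym : ∀ p q → adjacent p q ≡ adjacent q p
    adjacent-sym (inj₁ _) (inj₁ _) = refl
    adjacent-sym (inj₁ _) (inj₂ _) = refl
    adjacent-sym (inj₂ _) (inj₁ _) = refl
    adjacent-sym (inj₂ _) (inj₂ _) = refl

    adjacent-irrefl : ∀ p → adjacent p p ≡ false
    adjacent-irrefl (inj₁ _) = refl
    adjacent-irrefl (inj₂ _) = refl

    lift : (Node → Bool) → Subset n
    lift b = tabulate (b ∘ node)

    graph : Graph
    graph = record
      { order = n
      ; N = λ v → lift (adjacent (node v))
      ; symmetric = λ {u} {v} u∈ → Equivalence.from (∈-tabulate _)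
          (trans (adjacent-sym (node u) (node v)) (Equivalence.to (∈-tabulate _) u∈))
      ; irreflexive = λ {v} v∈ →
          case trans (sym (Equivalence.to (∈-tabulate _) v∈)) (adjacent-irrefl (node v)) of λ ()
      }

    τ : Fin n → ℕ
    τ = strictMajority graph

    hub : Fin k → Fin n
    hub u = u ↑ˡ (m * l)

    node-hub : ∀ u → node (hub u) ≡ inj₁ u
    node-hub u rewrite Fin.splitAt-↑ˡ k u (m * l) = refl

    hyperedge : Fin m → Fin l → Fin n
    hyperedge c e = k ↑ʳ combine c e

    node-hyperedge : ∀ c e → node (hyperedge c e) ≡ inj₂ e
    node-hyperedge c e rewrite Fin.splitAt-↑ʳ k (m * l) (combine c e) =
      cong (inj₂ ∘ proj₂) (Fin.remQuot-combine c e)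

    ∣lift∣ : ∀ b → ∣ lift b ∣ ≡ ∣ tabulate (b ∘ inj₁) ∣ + m * ∣ tabulate (b ∘ inj₂) ∣
    ∣lift∣ b = begin
      _ ≡⟨ ∣tabulate-+∣ k _ ⟩
      _ ≡⟨ cong₂ (λ A B → ∣ A ∣ + ∣ B ∣) (Vec.tabulate-cong (λ u → cong b (node-hub u)))
             (Vec.tabulate-cong λ i → cong (b ∘ map₂ _) (Fin.splitAt-↑ʳ k (m * l) i)) ⟩
      _ ≡⟨ cong (_ +_) (∣tabulate-remQuot∣ m (b ∘ inj₂)) ⟩
      _ ∎
      where open ≡-Reasoning

    -- These are the vertex sets on which all twins of a hyperedge agree. They are closed under the
    -- process, which acts on them as on the hypergraph itself.
    ⟦_,_⟧ : Subset k → Subset l → Subset n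
    ⟦ x , y ⟧ = lift [ lookup x , lookup y ]

    ⟦,⟧-zipWith : ∀ (_•_ : Bool → Bool → Bool) x x′ y y′ →
      zipWith _•_ ⟦ x , y ⟧ ⟦ x′ , y′ ⟧ ≡
      ⟦ zipWith _•_ x x′ , zipWith _•_ y y′ ⟧
    ⟦,⟧-zipWith _•_ x x′ y y′ =
      trans (zipWith-tabulate _•_ _ _) (Vec.tabulate-cong λ v → pointwise (node v))
      where
      pointwise : ∀ p → [ lookup x , lookup y ] p • [ lookup x′ , lookup y′ ] p ≡
                        [ lookup (zipWith _•_ x x′) , lookup (zipWith _•_ y y′) ] p
      pointwise (inj₁ u) = sym (Vec.lookup-zipWith _•_ u x x′)
      pointwise (inj₂ e) = sym (Vec.lookup-zipWith _•_ e y y′)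

    ∣⟦,⟧∣ : ∀ x y → ∣ ⟦ x , y ⟧ ∣ ≡ ∣ x ∣ + m * ∣ y ∣
    ∣⟦,⟧∣ x y = trans (∣lift∣ [ lookup x , lookup y ])
      (cong₂ (λ A B → ∣ A ∣ + m * ∣ B ∣) (Vec.tabulate∘lookup x) (Vec.tabulate∘lookup y))

    ∣⟦⊥,⟧∣ : ∀ y → ∣ ⟦ ⊥ , y ⟧ ∣ ≡ m * ∣ y ∣
    ∣⟦⊥,⟧∣ y = trans (∣⟦,⟧∣ ⊥ y) (cong (_+ m * ∣ y ∣) (∣⊥∣≡0 k))

    ∣⟦,⊥⟧∣ : ∀ x → ∣ ⟦ x , ⊥ ⟧ ∣ ≡ ∣ x ∣
    ∣⟦,⊥⟧∣ x = trans (∣⟦,⟧∣ x ⊥) (trans (cong (λ z → ∣ x ∣ + m * z) (∣⊥∣≡0 l))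
      (trans (cong (∣ x ∣ +_) (ℕ.*-zeroʳ m)) (ℕ.+-identityʳ ∣ x ∣)))

    ⟦⊥,⊥⟧ : ⟦ ⊥ , ⊥ ⟧ ≡ ⊥
    ⟦⊥,⊥⟧ = trans (Vec.tabulate-cong λ v → pointwise (node v)) (tabulate-replicate outside)
      where
      pointwise : ∀ p → [ lookup ⊥ , lookup ⊥ ] p ≡ outside
      pointwise (inj₁ u) = Vec.lookup-replicate u outside
      pointwise (inj₂ e) = Vec.lookup-replicate e outside

    ⟦⊤,⊤⟧ : ⟦ ⊤ , ⊤ ⟧ ≡ ⊤
    ⟦⊤,⊤⟧ = trans (Vec.tabulate-cong λ v → pointwise (node v)) (tabulate-replicate inside)
      where
      pointwise : ∀ p → [ lookup ⊤ , lookup ⊤ ] p ≡ inside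
      pointwise (inj₁ u) = Vec.lookup-replicate u inside
      pointwise (inj₂ e) = Vec.lookup-replicate e inside

    neighbours : Node → Subset n
    neighbours = [ (λ u → ⟦ ⊥ , hyperedges u ⟧) , (λ e → ⟦ hubs e , ⊥ ⟧) ]

    N-neighbours : ∀ v → N graph v ≡ neighbours (node v)
    N-neighbours v = go (node v)
      where
      hub-pointwise : ∀ u p → adjacent (inj₁ u) p ≡ [ lookup ⊥ , lookup (hyperedges u) ] p
      hub-pointwise u (inj₁ u′) = sym (Vec.lookup-replicate u′ outside)
      hub-pointwise u (inj₂ e)  = sym (Vec.lookup∘tabulate (inc u) e)
      hyperedge-pointwise : ∀ e p → adjacent (inj₂ e) p ≡ [ lookup (hubs e) , lookup ⊥ ] p
      hyperedge-pointwise e (inj₁ u)  = sym (Vec.lookup∘tabulate (λ u → inc u e) u)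
      hyperedge-pointwise e (inj₂ e′) = sym (Vec.lookup-replicate e′ outside)
      go : ∀ p → lift (adjacent p) ≡ neighbours p
      go (inj₁ u) = Vec.tabulate-cong λ v → hub-pointwise u (node v)
      go (inj₂ e) = Vec.tabulate-cong λ v → hyperedge-pointwise e (node v)

    neighbours-∩-hub : ∀ u x y → neighbours (inj₁ u) ∩ ⟦ x , y ⟧ ≡ ⟦ ⊥ , hyperedges u ∩ y ⟧
    neighbours-∩-hub u x y = trans (⟦,⟧-zipWith _∧_ ⊥ x (hyperedges u) y)
      (cong (λ x → ⟦ x , hyperedges u ∩ y ⟧) (∩-zeroˡ x))

    neighbours-∩-hyperedge : ∀ e x y → neighbours (inj₂ e) ∩ ⟦ x , y ⟧ ≡ ⟦ hubs e ∩ x , ⊥ ⟧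
    neighbours-∩-hyperedge e x y = trans (⟦,⟧-zipWith _∧_ (hubs e) x ⊥ y)
      (cong (λ y → ⟦ hubs e ∩ x , y ⟧) (∩-zeroˡ y))

    module _ .{{_ : NonZero m}} where

      -- At a hub, the degree and the active count are both `m` times their hypergraph values, and
      -- the nonzero factor cancels. At a hyperedge vertex the neighbours are hubs, which have no
      -- twins, so the counts agree outright.
      step-⟦,⟧ : ∀ x y → step graph τ ⟦ x , y ⟧ ≡ ⟦ stepHubs y , stepHyperedges x ⟧
      step-⟦,⟧ x y = Vec.tabulate-cong λ v → trans
        (cong (λ A → does (⌈ ∣ A ∣ + 1 /2⌉ ℕ.≤? ∣ A ∩ ⟦ x , y ⟧ ∣)) (N-neighbours v)) (go (node v))
        where
        go : ∀ p → does (⌈ ∣ neighbours p ∣ + 1 /2⌉ ℕ.≤? ∣ neighbours p ∩ ⟦ x , y ⟧ ∣) ≡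
                   [ lookup (stepHubs y) , lookup (stepHyperedges x) ] p
        go (inj₁ u) = trans
          (does-⇔ (scale ⇔-∘ ⌈n+1/2⌉≤c⇔n<c+c _ _) (_ ℕ.≤? _) (_ ℕ.<? _))
          (sym (Vec.lookup∘tabulate _ u))
          where
          d = ∣ hyperedges u ∣
          c = ∣ hyperedges u ∩ y ∣
          count : ∣ neighbours (inj₁ u) ∩ ⟦ x , y ⟧ ∣ ≡ m * c
          count = trans (cong ∣_∣ (neighbours-∩-hub u x y)) (∣⟦⊥,⟧∣ (hyperedges u ∩ y))
          scale : ∣ neighbours (inj₁ u) ∣ < ∣ neighbours (inj₁ u) ∩ ⟦ x , y ⟧ ∣ +
                    ∣ neighbours (inj₁ u) ∩ ⟦ x , y ⟧ ∣ ⇔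
                  d < c + c
          scale rewrite count | ∣⟦⊥,⟧∣ (hyperedges u) | sym (ℕ.*-distribˡ-+ m c c) =
            mk⇔ (ℕ.*-cancelˡ-< m d (c + c)) (ℕ.*-monoʳ-< m)
        go (inj₂ e) = trans
          (does-⇔ (subst₂ (λ d c → d < c + c ⇔ ∣ hubs e ∣ < ∣ hubs e ∩ x ∣ + ∣ hubs e ∩ x ∣)
                     (sym (∣⟦,⊥⟧∣ (hubs e))) (sym count) (mk⇔ id id)
                   ⇔-∘ ⌈n+1/2⌉≤c⇔n<c+c _ _) (_ ℕ.≤? _) (_ ℕ.<? _))
          (sym (Vec.lookup∘tabulate _ e))
          where
          count : ∣ neighbours (inj₂ e) ∩ ⟦ x , y ⟧ ∣ ≡ ∣ hubs e ∩ x ∣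
          count = trans (cong ∣_∣ (neighbours-∩-hyperedge e x y)) (∣⟦,⊥⟧∣ (hubs e ∩ x))

      0<deg : (∀ u → 0 < ∣ hyperedges u ∣) → (∀ e → 0 < ∣ hubs e ∣) → ∀ v → 0 < deg graph v
      0<deg 0<hyperedges 0<hubs v rewrite N-neighbours v = go (node v)
        where
        go : ∀ p → 0 < ∣ neighbours p ∣
        go (inj₁ u) rewrite ∣⟦⊥,⟧∣ (hyperedges u) = ℕ.*-mono-< (>-nonZero⁻¹ m) (0<hyperedges u)
        go (inj₂ e) rewrite ∣⟦,⊥⟧∣ (hubs e) = 0<hubs e

    0<τ : ∀ v → 0 < τ v
    0<τ v rewrite ℕ.+-comm (deg graph v) 1 = s≤s z≤n

    embed : SeededState → State graph τ
    embed (x , y , u) = ⟦ x , y ⟧ , ⟦ u , ⊥ ⟧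

    ⇝⇒⟶ : .{{NonZero m}} → ∀ {σ σ′} → σ ⇝ σ′ → _⟶_ graph τ (embed σ) (embed σ′)
    ⇝⇒⟶ {x , y , u} (s , s∩u , refl) = ⟦ s , ⊥ ⟧ ,
      subst Empty (sym (trans (⟦,⟧-zipWith _∧_ s u ⊥ ⊥) (trans (cong₂ ⟦_,_⟧ s∩u (∩-zeroˡ ⊥)) ⟦⊥,⊥⟧)))
        (λ (_ , ∈⊥) → ∉⊥ ∈⊥) ,
      cong₂ _,_
        (sym (trans (cong (step graph τ)
                      (trans (⟦,⟧-zipWith _∨_ s x ⊥ y) (cong (λ y → ⟦ s ∪ x , y ⟧) (∪-identityˡ y))))
                    (step-⟦,⟧ (s ∪ x) y)))
        (sym (trans (⟦,⟧-zipWith _∨_ u s ⊥ ⊥) (cong (λ y → ⟦ u ∪ s , y ⟧) (∪-identityˡ ⊥))))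

    -- Since hubs are not duplicated, the final seeded set `⟦ ⊤ , ⊥ ⟧` has `k` elements whatever `m`
    -- is.
    Star-embed : .{{NonZero m}} → Star _⇝_ (⊥ , ⊥ , ⊥) (⊤ , ⊤ , ⊤) →
                 Star (_⟶_ graph τ) (⊥ , ⊥) (⊤ , ⟦ ⊤ , ⊥ ⟧)
    Star-embed steps = subst₂ (Star (_⟶_ graph τ))
      (cong₂ _,_ ⟦⊥,⊥⟧ ⟦⊥,⊥⟧) (cong (_, ⟦ ⊤ , ⊥ ⟧) ⟦⊤,⊤⟧)
      (gmap {T = _⇝_} embed (λ {σ} {σ′} → ⇝⇒⟶ {σ} {σ′}) steps)

    -- Small sets never activate both sides

    Hubless Hyperedgeless : Subset n → Set
    Hubless       A = ∀ {v u} → node v ≡ inj₁ u → v ∉ A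
    Hyperedgeless A = ∀ {v e} → node v ≡ inj₂ e → v ∉ A

    -- A strict majority threshold is at least 1 even at degree 0, so activation always needs an
    -- active neighbour.
    N-empty : ∀ {A v} → (∀ {w} → w ∈ A → adjacent (node v) (node w) ≡ false) → v ∉ step graph τ A
    N-empty {A} {v} isolated v∈ = ℕ.<⇒≱ (0<τ v) (ℕ.≤-trans (Equivalence.to (∈-step graph τ) v∈)
      (ℕ.≤-reflexive (trans (cong ∣_∣ (Empty-unique nothing)) (∣⊥∣≡0 n))))
      where
      nothing : Empty (N graph v ∩ A)
      nothing (w , w∈) with w∈N , w∈A ← x∈p∩q⁻ (N graph v) A w∈ =
        case trans (sym (Equivalence.to (∈-tabulate _) w∈N)) (isolated w∈A) of λ ()

    hubless⇒hyperedgeless : ∀ {A} → Hubless A → Hyperedgeless (step graph τ A)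
    hubless⇒hyperedgeless {A} hubless {v} {e} node≡ = N-empty λ w∈A → go w∈A refl
      where
      go : ∀ {w p} → w ∈ A → node w ≡ p → adjacent (node v) (node w) ≡ false
      go {p = inj₁ _} w∈A eq = contradiction w∈A (hubless eq)
      go {p = inj₂ _} _   eq = cong₂ adjacent node≡ eq

    hyperedgeless⇒hubless : ∀ {A} → Hyperedgeless A → Hubless (step graph τ A)
    hyperedgeless⇒hubless {A} hyperedgeless {v} {u} node≡ = N-empty λ w∈A → go w∈A refl
      where
      go : ∀ {w p} → w ∈ A → node w ≡ p → adjacent (node v) (node w) ≡ false
      go {p = inj₁ _} _   eq = cong₂ adjacent node≡ eq
      go {p = inj₂ _} w∈A eq = contradiction w∈A (hyperedgeless eq)

    module _ (0<hyperedges : ∀ u → 0 < ∣ hyperedges u ∣) where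

      -- Every hub lies on a hyperedge and so has degree at least `m`. Its activation needs more
      -- than half of that many active vertices.
      small⇒hubless : ∀ {A} → ∣ A ∣ + ∣ A ∣ ≤ m → Hubless (step graph τ A)
      small⇒hubless {A} small {v} {u} node≡ v∈ = ℕ.<-irrefl refl (begin-strict
        m                            ≡⟨ ℕ.*-identityʳ m ⟨
        m * 1                        ≤⟨ ℕ.*-monoʳ-≤ m (0<hyperedges u) ⟩
        m * ∣ hyperedges u ∣         ≡⟨ ∣⟦⊥,⟧∣ (hyperedges u) ⟨
        ∣ neighbours (inj₁ u) ∣      ≡⟨ cong ∣_∣ (trans (N-neighbours v) (cong neighbours node≡)) ⟨
        deg graph v                  <⟨ Equivalence.to (⌈n+1/2⌉≤c⇔n<c+c _ _) (ℕ.≤-trans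
                                          (Equivalence.to (∈-step graph τ) v∈) (∣p∩q∣≤∣q∣ (N graph v) A)) ⟩
        ∣ A ∣ + ∣ A ∣                ≤⟨ small ⟩
        m                            ∎)
        where open ℕ.≤-Reasoning

      -- Bipartiteness makes the empty side switch at every step. The claim begins at time 1 because
      -- `S` itself may meet both sides.
      small⇒alternates : ∀ {S} → ∣ S ∣ + ∣ S ∣ ≤ m → ∀ i →
        Hubless (positive graph τ S (suc i)) ⊎ Hyperedgeless (positive graph τ S (suc i))
      small⇒alternates small zero = inj₁ (small⇒hubless small)
      small⇒alternates small (suc i) with small⇒alternates small i
      ... | inj₁ hubless       = inj₂ (hubless⇒hyperedgeless hubless)
      ... | inj₂ hyperedgeless = inj₁ (hyperedgeless⇒hubless hyperedgeless)

      small⇒¬targetSet : .{{NonZero m}} → Fin k → Fin l →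
        ∀ {S} → ∣ S ∣ + ∣ S ∣ ≤ m → ¬ IsTargetSet graph τ S
      -- Time 0 lies outside the alternation: there `S` is `⊤`, which already has more than `m`
      -- vertices.
      small⇒¬targetSet u e small (zero , refl) = ℕ.<⇒≱ (begin-strict
        m                        ≡⟨ ℕ.*-identityʳ m ⟨
        m * 1                    ≤⟨ ℕ.*-monoʳ-≤ m (ℕ.≤-trans (s≤s z≤n) (Fin.toℕ<n e)) ⟩
        m * l                    <⟨ ℕ.m<n+m (m * l) (ℕ.≤-trans (s≤s z≤n) (Fin.toℕ<n u)) ⟩
        n                        ≡⟨ ∣⊤∣≡n n ⟨
        ∣ ⊤ {n} ∣                ≤⟨ ℕ.m≤m+n _ _ ⟩
        ∣ ⊤ {n} ∣ + ∣ ⊤ {n} ∣    ∎) small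
        where open ℕ.≤-Reasoning
      small⇒¬targetSet u e small (suc i , all) with small⇒alternates small i
      ... | inj₁ hubless       = hubless (node-hub u) (subst (hub u ∈_) (sym all) ∈⊤)
      ... | inj₂ hyperedgeless = hyperedgeless (node-hyperedge copy e)
                                   (subst (hyperedge copy e ∈_) (sym all) ∈⊤)
        where
        copy : Fin m
        copy = fromℕ< (>-nonZero⁻¹ m)

-- The hypergraph on eight hubs

triple : Fin 8 → Fin 8 → Fin 8 → Subset 8
triple a b c = ⁅ a ⁆ ∪ ⁅ b ⁆ ∪ ⁅ c ⁆

-- Consecutive entries, here and in `simpleEdges`, are mirror images under 2i ↔ 2i + 1. With these
-- six counted twice, hubs 0 to 3 have degree 5, hubs 4 and 5 degree 3, and hubs 6 and 7 degree 11,
-- so they need 3, 2 and 6 active hyperedges respectively. A hyperedge needs two of its three hubs.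
doubleEdges : Vec (Subset 8) 6
doubleEdges
  = triple (# 0) (# 3) (# 6) ∷ triple (# 1) (# 2) (# 7)
  ∷ triple (# 0) (# 5) (# 6) ∷ triple (# 1) (# 4) (# 7)
  ∷ triple (# 2) (# 6) (# 7) ∷ triple (# 3) (# 6) (# 7) ∷ []

simpleEdges : Vec (Subset 8) 4
simpleEdges
  = triple (# 0) (# 6) (# 7) ∷ triple (# 1) (# 6) (# 7)
  ∷ triple (# 2) (# 5) (# 7) ∷ triple (# 3) (# 4) (# 6) ∷ []

-- The multiplicities come from a search over trajectories: for a prescribed trajectory, the
-- majority conditions are linear inequalities in the multiplicities of the hyperedges.
incidence : Fin 8 → Fin 16 → Bool
incidence u e = lookup (lookup (doubleEdges ++ doubleEdges ++ simpleEdges) e) u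

open Hypergraph incidence

-- Observed every second step, the first half has active hubs {0,3,5,6} after the seeds {0,4,6}; hub
-- 4 is lost. Adding the seed 2 gives {0,2,3,5,6,7}, then all hubs but 4, then all. The mirror half
-- runs one step behind: when the first half fills the hubs, the other, active on all hubs but 5 one
-- step earlier, fills the hyperedges. Each hub is seeded exactly once, so the seeded set ends as
-- `⊤`.
ignition : Star _⇝_ (⊥ , ⊥ , ⊥) (⊤ , ⊤ , ⊤)
ignition =
    (triple (# 0) (# 4) (# 6) , refl , refl)
  ◅ (triple (# 1) (# 5) (# 7) , refl , refl)
  ◅ (⁅ # 2 ⁆ , refl , refl)
  ◅ (⁅ # 3 ⁆ , refl , refl)
  ◅ (⊥ , refl , refl)
  ◅ (⊥ , refl , refl)
  ◅ (⊥ , refl , refl)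
  ◅ (⊥ , refl , refl)
  ◅ ε

0<hyperedges : ∀ u → 0 < ∣ hyperedges u ∣
0<hyperedges = from-yes (Fin.all? λ u → 0 ℕ.<? ∣ hyperedges u ∣)

0<hubs : ∀ e → 0 < ∣ hubs e ∣
0<hubs = from-yes (Fin.all? λ e → 0 ℕ.<? ∣ hubs e ∣)

theorem1 : Σ[ G ∈ (ℕ → Graph) ] ∃[ mt ] ∃[ mdtt ]
    ( TendsToInfinity (λ j → order (G j))
    × (∀ j → IsThresholdAssignment (G j) (strictMajority (G j)))
    × (∀ j → IsMT (G j) (strictMajority (G j)) (mt j))
    × (∀ j → IsMDTT (G j) (strictMajority (G j)) (mdtt j))
    × RatioTendsToInfinity mt mdtt )
theorem1 =
  -- The shift by `suc` keeps the number of twins nonzero; with no twins every hub would be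
  -- isolated, with threshold 1 above its degree 0. The constant 8 is the number of hubs.
  let mt , mdtt , isMT , isMDTT , ratio = unbounded-ratio (graph ∘ suc) (τ ∘ suc) 8
        (λ j small → small⇒¬targetSet (suc j) 0<hyperedges zero zero (ℕ.m≤n⇒m≤1+n small))
        (λ j → ⟦_,_⟧ (suc j) ⊤ ⊥ , Star-embed (suc j) ignition , ℕ.≤-reflexive (∣⟦,⊥⟧∣ (suc j) ⊤))
  in graph ∘ suc , mt , mdtt , (λ M → M , λ j M≤j → ℕ.≤-trans M≤j (j≤order j)) , threshold ,
     isMT , isMDTT , ratio
  where
  open Twins
  j≤order : ∀ j → j ≤ order (graph (suc j))
  j≤order j = begin
    j               ≤⟨ ℕ.n≤1+n j ⟩
    suc j           ≤⟨ ℕ.m≤m*n (suc j) 16 ⟩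
    suc j * 16      ≤⟨ ℕ.m≤n+m (suc j * 16) 8 ⟩
    8 + suc j * 16  ∎
    where open ℕ.≤-Reasoning
  threshold : ∀ j → IsThresholdAssignment (graph (suc j)) (τ (suc j))
  -- With `d` in both places the majority inequality reads `d < d + d`, which is positivity of the
  -- degree.
  threshold j v = Equivalence.from (⌈n+1/2⌉≤c⇔n<c+c d d)
    (ℕ.m<m+n d (0<deg (suc j) 0<hyperedges 0<hubs v))
    where d = deg (graph (suc j)) v
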